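{- Let $\kappa$ be an infinite cardinal, let $n$ be a positive integer, and let $P$ be a join-semilattice of breadth $n$ and cardinality $\kappa^{+(n-1)}$ whose principal ideals have cardinality $<\kappa$. Then, for every ideal $I\subseteq P$ of cardinality at most $\kappa$, there exists $x\in P$ such that $x\vee I$ is a chain.
   Context: $\kappa^{+(n-1)}$ denotes the $(n-1)$-st cardinal successor of $\kappa$ (so $\kappa^{+0}=\kappa$). Join-semilattices are nonempty; $x\le y$ iff $x\vee y=y$. A nonempty subset of a join-semilattice closed under binary joins is a join-subsemilattice; an ideal is a downward closed join-subsemilattice. The principal ideals of $P$ are the sets $\{y\in P:y\le x\}$, $x\in P$. For $x\in P$ and nonempty $S\subseteq P$, $x\vee S=\{x\vee y:y\in S\}$. $P$ has breadth at most $m$ ($m\in\omega$) if for every nonempty finite $X\subseteq P$ there is $Y\subseteq X$ with at most $m$ elements such that $\bigvee X=\bigvee Y$ (writing $\bigvee\emptyset$ means that $P$ has a least element $0_P$ and $\bigvee\emptyset=0_P$); the breadth of $P$ is the least such $m$, if one exists. -}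

module Defs where

open import Algebra.Lattice.Bundles using (JoinSemilattice)
open import Data.List.Base using (List; []; _∷_; length)
open import Data.List.NonEmpty.Base using (List⁺; toList; foldr₁) renaming (_∷_ to _∷⁺_)
open import Data.Nat.Base using (ℕ; zero; suc; _≤_; _<_)
open import Data.Product.Base using (Σ; ∃-syntax; _×_; proj₁)
open import Data.Sum.Base using (_⊎_)
open import Function.Bundles using (Bijection; Injection)
open import Induction.WellFounded using (WellFounded)
open import Level using (Level; _⊔_) renaming (suc to lsuc)
open import Relation.Binary.Bundles using (Setoid)
open import Relation.Binary.Core using (Rel)
open import Relation.Binary.PropositionalEquality.Core using (_≡_)
import Relation.Binary.PropositionalEquality.Properties as ≡
import Relation.Binary.Construct.On as On
open import Relation.Binary.Structures using (IsStrictTotalOrder)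
open import Relation.Nullary.Negation.Core using (¬_)
open import Relation.Unary using (Pred; _∈_; Satisfiable)
import Data.List.Relation.Binary.Subset.Setoid as Subset

private
  variable
    a b ℓ₁ ℓ₂ ℓ : Level

------------------------------------------------------------------------
-- Cardinals
--
-- As usual in ZFC, a cardinal is an initial ordinal.  Since cardinals
-- are well-ordered by definition, "A has cardinality κ" already contains
-- the well-orderability that choice would provide.

infix 4 _≼_ _≺_

-- ∣A∣ ≤ ∣B∣ and ∣A∣ < ∣B∣, for sets presented as setoids.

_≼_ : Setoid a ℓ₁ → Setoid b ℓ₂ → Set (a ⊔ b ⊔ ℓ₁ ⊔ ℓ₂)
A ≼ B = Injection A B

_≺_ : Setoid a ℓ₁ → Setoid b ℓ₂ → Set (a ⊔ b ⊔ ℓ₁ ⊔ ℓ₂)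
A ≺ B = A ≼ B × ¬ (B ≼ A)

-- Elements are compared by their underlying elements of S, so the proofs
-- of membership do not count towards the cardinality.

subset : (S : Setoid a ℓ₁) → Pred (Setoid.Carrier S) ℓ₂ → Setoid (a ⊔ ℓ₂) ℓ₁
subset S X = On.setoid {B = Σ (Setoid.Carrier S) X} S proj₁

record Cardinal ℓ : Set (lsuc ℓ) where
  infix 4 _<ᵒ_
  field
    Carrier            : Set ℓ
    _<ᵒ_               : Rel Carrier ℓ
    isStrictTotalOrder : IsStrictTotalOrder _≡_ _<ᵒ_
    wellFounded        : WellFounded _<ᵒ_

  setoid : Setoid ℓ ℓ
  setoid = ≡.setoid Carrier

  field
    initial : ∀ α → ¬ (setoid ≼ subset setoid (_<ᵒ α))

∣_∣ : Cardinal ℓ → Setoid ℓ ℓ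
∣ κ ∣ = Cardinal.setoid κ

HasCardinality : Setoid a ℓ₁ → Cardinal ℓ → Set (a ⊔ ℓ₁ ⊔ ℓ)
HasCardinality A κ = Bijection A ∣ κ ∣

Infinite : Cardinal ℓ → Set ℓ
Infinite κ = ≡.setoid ℕ ≼ ∣ κ ∣

-- μ is the least cardinal greater than κ.

IsSuccessor : Cardinal ℓ → Cardinal ℓ → Set (lsuc ℓ)
IsSuccessor {ℓ} κ μ =
  ∣ κ ∣ ≺ ∣ μ ∣ × (∀ (ν : Cardinal ℓ) → ∣ κ ∣ ≺ ∣ ν ∣ → ∣ μ ∣ ≼ ∣ ν ∣)

-- IsIteratedSuccessor κ m μ  says that  μ  is the m-th successor  κ⁺ᵐ.

data IsIteratedSuccessor {ℓ} (κ : Cardinal ℓ) : ℕ → Cardinal ℓ → Set (lsuc ℓ) where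
  zero : ∀ {μ} → HasCardinality ∣ κ ∣ μ → IsIteratedSuccessor κ zero μ
  suc  : ∀ {m ν μ} → IsIteratedSuccessor κ m ν → IsSuccessor ν μ →
         IsIteratedSuccessor κ (suc m) μ

------------------------------------------------------------------------
-- Join-semilattices

module SemilatticeNotions {c ℓ : Level} (P : JoinSemilattice c ℓ) where

  open JoinSemilattice P using (Carrier; _≈_; _∨_; setoid)
  open Subset setoid using (_⊆_)

  infix 4 _⊑_
  infixr 7 _∨ˢ_

  _⊑_ : Rel Carrier ℓ
  x ⊑ y = x ∨ y ≈ y

  ↓_ : Carrier → Pred Carrier ℓ
  ↓ x = _⊑ x

  -- Finite sets are presented by lists, so that "at most m elements" means
  -- "listed with length at most m".  IsJoin xs z says that ⋁ xs exists
  -- and equals z; if xs is empty, this means that z is the least element.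

  data IsJoin : List Carrier → Carrier → Set (c ⊔ ℓ) where
    empty    : ∀ {z} → (∀ y → z ⊑ y) → IsJoin [] z
    nonempty : ∀ {x xs z} → foldr₁ _∨_ (x ∷⁺ xs) ≈ z → IsJoin (x ∷ xs) z

  BreadthAtMost : ℕ → Set (c ⊔ ℓ)
  BreadthAtMost m = ∀ (X : List⁺ Carrier) →
    ∃[ Y ] Y ⊆ toList X × length Y ≤ m × IsJoin Y (foldr₁ _∨_ X)

  HasBreadth : ℕ → Set (c ⊔ ℓ)
  HasBreadth n = BreadthAtMost n × (∀ m → m < n → ¬ BreadthAtMost m)

  record IsIdeal {i} (I : Pred Carrier i) : Set (c ⊔ ℓ ⊔ i) where
    field
      inhabited  : Satisfiable I
      ∨-closed   : ∀ {x y} → x ∈ I → y ∈ I → x ∨ y ∈ I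
      downClosed : ∀ {x y} → x ⊑ y → y ∈ I → x ∈ I

  _∨ˢ_ : ∀ {i} → Carrier → Pred Carrier i → Pred Carrier (c ⊔ ℓ ⊔ i)
  (x ∨ˢ S) z = ∃[ y ] y ∈ S × z ≈ x ∨ y

  IsChain : ∀ {i} → Pred Carrier i → Set (c ⊔ ℓ ⊔ i)
  IsChain S = ∀ {x y} → x ∈ S → y ∈ S → x ⊑ y ⊎ y ⊑ x

{-# OPTIONS --safe #-}

-- Put m = n ∸ 1.  Choose x₁, …, xₘ, with xₖ among κ⁺ᵏ many elements of P, starting from xₘ, such
-- that no xₖ lies below  z ∨ xₘ ∨ … ∨ xₖ₊₁ ∨ (xₖ₋₁ ∨ … ∨ x₁ ∨ u)  for u ∈ I, where z ∈ I is fixed.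
-- If xₖ did not exist, each of the κ⁺ᵏ candidates would be determined by a (k-1)-tuple from
-- κ⁺⁽ᵏ⁻¹⁾, a u ∈ I and a position in a principal ideal, i.e. by one of κ⁺⁽ᵏ⁻¹⁾ codes, as
-- λ · λ = λ for infinite λ.
-- Given u, v ∈ I, breadth n makes one of the n + 1 elements u, v, xₘ, …, x₁ lie below the join of
-- the others.  It is no xₖ, because u ∨ v ∈ I, so it is u or v, and u and v become comparable after
-- joining with  xₘ ∨ … ∨ x₁ ∨ z.

module Submission where

open import Defs
open import Algebra.Lattice.Bundles using (JoinSemilattice)
open import Axiom.ExcludedMiddle using (ExcludedMiddle)
open import Data.Empty using (⊥-elim)
open import Data.Fin.Base using (Fin; zero; suc)
open import Data.Fin.Properties using (_≟_; any?; ¬∀⟶∃¬; injective⇒≤)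
open import Data.List.Base as List using (_∷_; []; length)
open import Data.List.NonEmpty.Base using (foldr₁) renaming (_∷_ to _∷⁺_)
open import Data.Nat.Base as ℕ using (ℕ; suc; NonZero; _∸_)
import Data.Nat.Induction as ℕ
import Data.Nat.Properties as ℕ
open import Data.Product.Base using (∃-syntax; _×_; _,_; proj₁; proj₂; map₂)
open import Data.Product.Properties using (×-≡,≡→≡; ,-injective)
open import Data.Product.Relation.Binary.Lex.Strict using (×-Lex; ×-compare; ×-wellFounded)
open import Data.Sum.Base using (_⊎_; inj₁; inj₂; [_,_])
open import Data.Sum.Properties using (inj₁-injective; inj₂-injective)
open import Data.Sum.Relation.Binary.LeftOrder
  using (_⊎-<_; ₁∼₂; ₂∼₂; ⊎-<-transitive; ⊎-<-trichotomous; ⊎-<-wellFounded)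
open import Data.Sum.Relation.Binary.Pointwise using (Pointwise-≡⇒≡; ≡⇒Pointwise-≡)
open import Data.Unit.Polymorphic.Base using (⊤)
open import Data.Vec.Base using (Vec; []; _∷_; foldr′; lookup; map; toList)
open import Data.Vec.Properties using (map-∘)
open import Data.Vec.Relation.Unary.Any using (index)
open import Data.Vec.Relation.Unary.Any.Properties using (toList⁻; lookup-index)
open import Function.Base using (id; _∘_; _$_; _on_)
open import Function.Bundles using (_↣_; mk↣; Injection; Bijection)
open import Function.Construct.Composition using (injection)
open import Function.Definitions using (Injective)
open import Function.Properties.Bijection using (sym-≡)
open import Induction.WellFounded using (WellFounded; module All; module FixPoint)
open import Level using (_⊔_)
open import Relation.Binary.Bundles using (StrictTotalOrder)
open import Relation.Binary.Core using (Rel)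
open import Relation.Binary.Definitions using (Trichotomous; tri<; tri≈; tri>)
open import Relation.Binary.PropositionalEquality
  using (_≡_; _≢_; refl; sym; trans; cong; subst; isEquivalence)
open import Relation.Binary.Structures using (IsStrictTotalOrder)
open import Relation.Binary.Structures.Biased using (isStrictTotalOrderᶜ)
open import Relation.Nullary using (¬_; yes; no; contradiction)
open import Relation.Unary using (Pred; _∈_; _⊆_; _⟨×⟩_)
import Algebra.Construct.NaturalChoice.Max as Max
import Algebra.Construct.NaturalChoice.MaxOp as MaxOp
import Data.List.Membership.Setoid.Properties as Membership
import Relation.Binary.Construct.On as On
import Relation.Binary.Properties.StrictTotalOrder as StrictTotalOrderProperties

-- An injection from pairs of natural numbers into the natural numbers.

squareShell : ℕ × ℕ → ℕ
squareShell (x , y) = (x ℕ.+ y) ℕ.* (x ℕ.+ y) ℕ.+ x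

-- As `x ≤ s`, the value for the sum `s` lies between s² and s² + s, hence below (s + 1)², so
-- different sums occupy disjoint intervals.
squareShell-< : ∀ x y x′ y′ → x ℕ.+ y ℕ.< x′ ℕ.+ y′ → squareShell (x , y) ℕ.< squareShell (x′ , y′)
squareShell-< x y x′ y′ s<s′ = begin-strict
  s ℕ.* s ℕ.+ x         ≤⟨ ℕ.+-monoʳ-≤ (s ℕ.* s) (ℕ.m≤m+n x y) ⟩
  s ℕ.* s ℕ.+ s         ≡⟨ ℕ.+-comm (s ℕ.* s) s ⟩
  suc s ℕ.* s           <⟨ ℕ.*-monoʳ-< (suc s) (ℕ.n<1+n s) ⟩
  suc s ℕ.* suc s       ≤⟨ ℕ.*-mono-≤ s<s′ s<s′ ⟩
  s′ ℕ.* s′             ≤⟨ ℕ.m≤m+n (s′ ℕ.* s′) x′ ⟩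
  s′ ℕ.* s′ ℕ.+ x′      ∎
  where
  open ℕ.≤-Reasoning
  s  = x ℕ.+ y
  s′ = x′ ℕ.+ y′

squareShell-injective : Injective _≡_ _≡_ squareShell
squareShell-injective {x , y} {x′ , y′} eq with ℕ.<-cmp (x ℕ.+ y) (x′ ℕ.+ y′)
... | tri< s<s′ _ _ = contradiction eq (ℕ.<⇒≢ (squareShell-< x y x′ y′ s<s′))
... | tri> _ _ s>s′ = contradiction (sym eq) (ℕ.<⇒≢ (squareShell-< x′ y′ x y s>s′))
... | tri≈ _ s≡s′ _ = ×-≡,≡→≡ (x≡x′ , ℕ.+-cancelˡ-≡ x y y′ (trans s≡s′ (cong (ℕ._+ y′) (sym x≡x′))))
  where
  x≡x′ = ℕ.+-cancelˡ-≡ ((x ℕ.+ y) ℕ.* (x ℕ.+ y)) x x′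
    (trans eq (cong (λ s → s ℕ.* s ℕ.+ x′) (sym s≡s′)))

-- Injections between subsets.

infix 8 _²

_² : ∀ {a} {X : Set a} → Pred X a → Pred (X × X) a
V ² = V ⟨×⟩ V

infix 4 _↪_

-- The map is defined on all of `X`, so its values do not depend on proofs of membership in `V`.
record _↪_ {a} {X Y : Set a} (V : Pred X a) (W : Pred Y a) : Set a where
  field
    to        : X → Y
    maps      : ∀ {x} → x ∈ V → to x ∈ W
    injective : ∀ {x y} → x ∈ V → y ∈ V → to x ≡ to y → x ≡ y

open _↪_

module _ {a} {X Y : Set a} {V : Pred X a} {W : Pred Y a} where

  infixr 9 _⨾_

  _⨾_ : ∀ {Z : Set a} {T : Pred Z a} → V ↪ W → W ↪ T → V ↪ T
  (f ⨾ g) .to                 = to g ∘ to f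
  (f ⨾ g) .maps               = maps g ∘ maps f
  (f ⨾ g) .injective x∈ y∈ eq = injective f x∈ y∈ (injective g (maps f x∈) (maps f y∈) eq)

  square : V ↪ W → V ² ↪ W ²
  square f .to (x , y)                           = to f x , to f y
  square f .maps (x∈ , y∈)                       = maps f x∈ , maps f y∈
  square f .injective (x∈ , y∈) (x′∈ , y′∈) eq with ,-injective eq
  ... | eq₁ , eq₂ = ×-≡,≡→≡ (injective f x∈ x′∈ eq₁ , injective f y∈ y′∈ eq₂)

⊆⇒↪ : ∀ {a} {X : Set a} {V W : Pred X a} → V ⊆ W → V ↪ W
⊆⇒↪ V⊆W .to              = id
⊆⇒↪ V⊆W .maps            = V⊆W
⊆⇒↪ V⊆W .injective _ _   = id

-- Least elements in a well-order.

module Least {ℓ} (em : ExcludedMiddle ℓ) {C : Set ℓ} {_<_ : Rel C ℓ}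
  (isStrictTotalOrder : IsStrictTotalOrder _≡_ _<_) (wellFounded : WellFounded _<_) where

  open IsStrictTotalOrder isStrictTotalOrder using (compare)

  IsLeast : Pred C ℓ → Pred C ℓ
  IsLeast V x = x ∈ V × (∀ {y} → y < x → ¬ y ∈ V)

  least : ∀ {V x} → x ∈ V → ∃[ y ] IsLeast V y
  least {V} {x} = All.wfRec wellFounded ℓ (λ x → x ∈ V → ∃[ y ] IsLeast V y) step x
    where
    step : ∀ x → (∀ {y} → y < x → y ∈ V → ∃[ z ] IsLeast V z) → x ∈ V → ∃[ y ] IsLeast V y
    step x rec x∈V with em {∃[ y ] y < x × y ∈ V}
    ... | yes (y , y<x , y∈V) = rec y<x y∈V
    ... | no ∄y               = x , x∈V , λ y<x y∈V → ∄y (_ , y<x , y∈V)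

  leastOr : C → Pred C ℓ → C
  leastOr default V with em {∃[ x ] IsLeast V x}
  ... | yes (x , _) = x
  ... | no _        = default

  leastOr-∈ : ∀ {default V x} → x ∈ V → leastOr default V ∈ V
  leastOr-∈ {V = V} x∈V with em {∃[ x ] IsLeast V x}
  ... | yes (_ , y∈V , _) = y∈V
  ... | no ∄y             = contradiction (least x∈V) ∄y

  -- A least element depends only on the extension of the predicate. This is what gives the
  -- recursive `code` its unfolding equation.
  leastOr-cong : ∀ {default V W} → V ⊆ W → W ⊆ V → leastOr default V ≡ leastOr default W
  leastOr-cong {V = V} {W} V⊆W W⊆V with em {∃[ x ] IsLeast V x} | em {∃[ x ] IsLeast W x}
  ... | no _   | no _            = refl
  ... | no ∄x  | yes (_ , x∈ , _) = contradiction (least (W⊆V x∈)) ∄x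
  ... | yes (_ , x∈ , _) | no ∄x = contradiction (least (V⊆W x∈)) ∄x
  ... | yes (x , x∈ , x<) | yes (y , y∈ , y<) with compare x y
  ...   | tri< x<y _ _ = contradiction (V⊆W x∈) (y< x<y)
  ...   | tri≈ _ x≡y _ = x≡y
  ...   | tri> _ _ y<x = contradiction (W⊆V y∈) (x< y<x)

-- Gödel's canonical well-ordering of pairs.

module CanonicalOrder {c} {C : Set c} {_<_ : Rel C c}
  (isStrictTotalOrder : IsStrictTotalOrder _≡_ _<_) (wellFounded : WellFounded _<_) where

  private
    strictTotalOrder : StrictTotalOrder c c c
    strictTotalOrder = record { isStrictTotalOrder = isStrictTotalOrder }

  open IsStrictTotalOrder isStrictTotalOrder using (compare)
  open StrictTotalOrderProperties strictTotalOrder public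
    using (_≤_; total; totalOrder) renaming (trans to ≤-trans; reflexive to ≤-reflexive)
  open Max totalOrder using (maxOperator) renaming (_⊔_ to _⊔ᶜ_)
  open MaxOp maxOperator using (x≤x⊔y; x≤y⊔x; ⊔-lub)

  infix 4 _⊏_

  abstract
    -- Comparing maxima first keeps all predecessors of a pair inside any square that contains it;
    -- the coordinates only break ties.
    _⊏_ : Rel (C × C) c
    _⊏_ = ×-Lex _≡_ _<_ (×-Lex _≡_ _<_ _<_) on λ (x , y) → x ⊔ᶜ y , x , y

    ⊏-wellFounded : WellFounded _⊏_
    ⊏-wellFounded = On.wellFounded _ (×-wellFounded wellFounded (×-wellFounded wellFounded wellFounded))

    ⊏-connex : ∀ p q → p ≢ q → p ⊏ q ⊎ q ⊏ p
    ⊏-connex (x , y) (x′ , y′) p≢q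
      with ×-compare sym compare (×-compare sym compare compare) (x ⊔ᶜ y , x , y) (x′ ⊔ᶜ y′ , x′ , y′)
    ... | tri< p⊏q _ _      = inj₁ p⊏q
    ... | tri≈ _ (_ , eq) _ = contradiction (×-≡,≡→≡ eq) p≢q
    ... | tri> _ _ q⊏p      = inj₂ q⊏p

    ⊏-bounded : ∀ {p q z} → q ⊏ p → p ∈ (_≤ z) ² → q ∈ (_≤ z) ²
    ⊏-bounded {x , y} {x′ , y′} {z} q⊏p (x≤z , y≤z) =
      ≤-trans (x≤x⊔y x′ y′) q≤z , ≤-trans (x≤y⊔x x′ y′) q≤z
      where
      q≤p : x′ ⊔ᶜ y′ ≤ x ⊔ᶜ y
      q≤p = [ inj₁ , ≤-reflexive ∘ proj₁ ] q⊏p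
      q≤z : x′ ⊔ᶜ y′ ≤ z
      q≤z = ≤-trans q≤p (⊔-lub x≤z y≤z)

-- Hessenberg's theorem that an infinite well-ordered set absorbs its square.

-- The union of ℕ with any initial segment of A is Dedekind-infinite, so the transfinite induction
-- for A × A ≼ A, run on these unions, meets no finite segments.

module Hessenberg {ℓ} (em : ExcludedMiddle ℓ) {A : Set ℓ} {_<_ : Rel A ℓ}
  (isStrictTotalOrder : IsStrictTotalOrder _≡_ _<_) (wellFounded : WellFounded _<_) where

  private
    module A = IsStrictTotalOrder isStrictTotalOrder

    B : Set ℓ
    B = ℕ ⊎ A

    _<ᴮ_ : Rel B ℓ
    _<ᴮ_ = ℕ._<_ ⊎-< _<_

    compareᴮ : Trichotomous _≡_ _<ᴮ_
    compareᴮ x y with ⊎-<-trichotomous ℕ.<-cmp A.compare x y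
    ... | tri< x<y x≉y x≯y = tri< x<y (x≉y ∘ ≡⇒Pointwise-≡) x≯y
    ... | tri≈ x≮y x≈y x≯y = tri≈ x≮y (Pointwise-≡⇒≡ x≈y) x≯y
    ... | tri> x≮y x≉y x>y = tri> x≮y (x≉y ∘ ≡⇒Pointwise-≡) x>y

    isStrictTotalOrderᴮ : IsStrictTotalOrder _≡_ _<ᴮ_
    isStrictTotalOrderᴮ = isStrictTotalOrderᶜ record
      { isEquivalence = isEquivalence
      ; trans         = ⊎-<-transitive ℕ.<-trans A.trans
      ; compare       = compareᴮ
      }

    wellFoundedᴮ : WellFounded _<ᴮ_
    wellFoundedᴮ = ⊎-<-wellFounded ℕ.<-wellFounded wellFounded

    open Least em isStrictTotalOrderᴮ wellFoundedᴮ
    open CanonicalOrder isStrictTotalOrderᴮ wellFoundedᴮ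

    infix 9 ℕ∪_

    ℕ∪_ : Pred A ℓ → Pred B ℓ
    ℕ∪ V = [ (λ _ → ⊤) , V ]

    ℕ∪-mono : ∀ {V W} → V ⊆ W → ℕ∪ V ⊆ ℕ∪ W
    ℕ∪-mono V⊆W {inj₁ _} _   = _
    ℕ∪-mono V⊆W {inj₂ _} x∈V = V⊆W x∈V

    Squarable : Pred A ℓ → Set ℓ
    Squarable V = ℕ∪ V ² ↪ ℕ∪ V

    -- Only the copy of ℕ is left, where `squareShell` applies; the value 0 of `nat` on `A` is a
    -- dummy.
    ∅-squarable : ∀ {V} → (∀ {α} → ¬ α ∈ V) → Squarable V
    ∅-squarable {V} ∉V = record
      { to        = λ (x , y) → inj₁ (squareShell (nat x , nat y))
      ; maps      = _
      ; injective = λ (x∈ , y∈) (x′∈ , y′∈) eq →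
          let eq₁ , eq₂ = ,-injective (squareShell-injective (inj₁-injective eq))
          in ×-≡,≡→≡ (nat-injective x∈ x′∈ eq₁ , nat-injective y∈ y′∈ eq₂)
      }
      where
      nat : B → ℕ
      nat = [ id , (λ _ → 0) ]

      nat-injective : ∀ {x y} → x ∈ ℕ∪ V → y ∈ ℕ∪ V → nat x ≡ nat y → x ≡ y
      nat-injective {inj₂ _} x∈ _ _         = contradiction x∈ ∉V
      nat-injective {_} {inj₂ _} _ y∈ _     = contradiction y∈ ∉V
      nat-injective {inj₁ _} {inj₁ _} _ _ eq = cong inj₁ eq

    -- Hilbert's hotel: the natural numbers move up by one and `α` takes the vacated 0.
    absorbTop : ∀ {α} → (_≤ inj₂ α) ↪ ℕ∪ (_< α)
    absorbTop     .to (inj₁ n) = inj₁ (suc n)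
    absorbTop {α} .to (inj₂ β) with A.compare β α
    ... | tri≈ _ _ _ = inj₁ 0
    ... | _          = inj₂ β
    absorbTop     .maps {inj₁ _} _ = _
    absorbTop {α} .maps {inj₂ β} β≤α with A.compare β α
    ... | tri< β<α _ _ = β<α
    ... | tri≈ _ _ _   = _
    ... | tri> β≮α β≢α _ with β≤α
    ...   | inj₁ (₂∼₂ β<α) = contradiction β<α β≮α
    ...   | inj₂ refl      = contradiction refl β≢α
    absorbTop     .injective {inj₁ _} {inj₁ _} _ _ refl = refl
    absorbTop {α} .injective {inj₁ _} {inj₂ γ} _ _ eq with A.compare γ α
    absorbTop     .injective {inj₁ _} {inj₂ γ} _ _ () | tri< _ _ _
    absorbTop     .injective {inj₁ _} {inj₂ γ} _ _ () | tri≈ _ _ _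
    absorbTop     .injective {inj₁ _} {inj₂ γ} _ _ () | tri> _ _ _
    absorbTop {α} .injective {inj₂ β} {inj₁ _} _ _ eq with A.compare β α
    absorbTop     .injective {inj₂ β} {inj₁ _} _ _ () | tri< _ _ _
    absorbTop     .injective {inj₂ β} {inj₁ _} _ _ () | tri≈ _ _ _
    absorbTop     .injective {inj₂ β} {inj₁ _} _ _ () | tri> _ _ _
    absorbTop {α} .injective {inj₂ β} {inj₂ γ} _ _ eq with A.compare β α | A.compare γ α
    absorbTop     .injective {inj₂ β} {inj₂ γ} _ _ _    | tri≈ _ refl _ | tri≈ _ refl _ = refl
    absorbTop     .injective {inj₂ β} {inj₂ γ} _ _ refl | tri< _ _ _ | tri< _ _ _ = refl
    absorbTop     .injective {inj₂ β} {inj₂ γ} _ _ refl | tri< _ _ _ | tri> _ _ _ = refl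
    absorbTop     .injective {inj₂ β} {inj₂ γ} _ _ refl | tri> _ _ _ | tri< _ _ _ = refl
    absorbTop     .injective {inj₂ β} {inj₂ γ} _ _ refl | tri> _ _ _ | tri> _ _ _ = refl

    module Step {V : Pred A ℓ} (downClosed : ∀ {α β} → β < α → α ∈ V → β ∈ V)
      (segments : ∀ {α} → α ∈ V → Squarable (_< α)) where

      Fresh : ∀ p → (∀ {q} → q ⊏ p → B) → Pred B ℓ
      Fresh p f b = b ∈ ℕ∪ V × (∀ q (q⊏p : q ⊏ p) → f q⊏p ≢ b)

      nextFresh : ∀ p → (∀ {q} → q ⊏ p → B) → B
      nextFresh p f = leastOr (inj₁ 0) (Fresh p f)

      nextFresh-cong : ∀ p {f g : ∀ {q} → q ⊏ p → B} →
        (∀ {q} (q⊏p : q ⊏ p) → f q⊏p ≡ g q⊏p) → nextFresh p f ≡ nextFresh p g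
      nextFresh-cong p f≗g = leastOr-cong
        (λ (b∈ , fresh) → b∈ , λ q q⊏p eq → fresh q q⊏p (trans (f≗g q⊏p) eq))
        (λ (b∈ , fresh) → b∈ , λ q q⊏p eq → fresh q q⊏p (trans (sym (f≗g q⊏p)) eq))

      abstract
        code : B × B → B
        code = All.wfRec ⊏-wellFounded ℓ (λ _ → B) nextFresh

        code-unfold : ∀ p → code p ≡ nextFresh p (λ {q} _ → code q)
        code-unfold p =
          FixPoint.unfold-wfRec ⊏-wellFounded (λ _ → B) nextFresh nextFresh-cong {p}

      CodesBelow : B × B → Pred B ℓ
      CodesBelow p b = ∀ q → q ⊏ p → code q ≢ b

      code-fresh : ∀ {p b} → b ∈ ℕ∪ V → b ∈ CodesBelow p → code p ∈ ℕ∪ V × code p ∈ CodesBelow p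
      code-fresh {p} {b} b∈V fresh =
        subst (Fresh p λ {q} _ → code q) (sym (code-unfold p))
          (leastOr-∈ {V = Fresh p λ {q} _ → code q} {b} (b∈V , fresh))

      -- The copy of ℕ precedes all of `A`, so the given `α` bounds it; an element of `V` bounds
      -- itself.
      bound₁ : ∀ {α x} → α ∈ V → x ∈ ℕ∪ V → ∃[ β ] β ∈ V × x ≤ inj₂ β
      bound₁ {x = inj₁ _} α∈V _  = _ , α∈V , inj₁ ₁∼₂
      bound₁ {x = inj₂ β} _ β∈V = β , β∈V , ≤-reflexive refl

      bound₂ : ∀ {α x y} → α ∈ V → x ∈ ℕ∪ V → y ∈ ℕ∪ V → ∃[ β ] β ∈ V × x ≤ inj₂ β × y ≤ inj₂ β
      bound₂ {x = x} {y} α∈V x∈ y∈ with total x y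
      ... | inj₁ x≤y = map₂ (map₂ λ y≤β → ≤-trans x≤y y≤β , y≤β) (bound₁ α∈V y∈)
      ... | inj₂ y≤x = map₂ (map₂ λ x≤β → x≤β , ≤-trans y≤x x≤β) (bound₁ α∈V x∈)

      -- With nothing fresh at `p`, each element of `ℕ∪ V` is the code of a predecessor of `p`, and
      -- these all lie in the square below `z`. Choosing one such predecessor inverts `code`.
      exhausted : ∀ {p z} → p ∈ (_≤ z) ² → (∀ b → b ∈ ℕ∪ V → ¬ b ∈ CodesBelow p) →
        ℕ∪ V ↪ (_≤ z) ²
      exhausted {p} {z} p≤z ∄fresh = record
        { to        = decode
        ; maps      = λ b∈ → ⊏-bounded (proj₁ (decodes b∈)) p≤z
        ; injective = λ b∈ c∈ eq →
            trans (sym (proj₂ (decodes b∈))) (trans (cong code eq) (proj₂ (decodes c∈)))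
        }
        where
        decode : B → B × B
        decode b with em {∃[ q ] q ⊏ p × code q ≡ b}
        ... | yes (q , _) = q
        ... | no _        = p

        decodes : ∀ {b} → b ∈ ℕ∪ V → decode b ⊏ p × code (decode b) ≡ b
        decodes {b} b∈ with em {∃[ q ] q ⊏ p × code q ≡ b}
        ... | yes (_ , hit) = hit
        ... | no ∄q         = ⊥-elim (∄fresh b b∈ λ q q⊏p eq → ∄q (q , q⊏p , eq))

      -- If the greedy codes run out at some pair, a proper segment bounds that pair and the
      -- induction hypothesis for it applies; otherwise `code` itself is the injection. Empty `V` is
      -- treated apart because the bounding segment needs an element of `V`.
      squarable : Squarable V
      squarable with em {∃[ α ] α ∈ V}
      ... | no ∄α = ∅-squarable (λ α∈V → ∄α (_ , α∈V))
      ... | yes (α , α∈V)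
        with em {∃[ p ] p ∈ ℕ∪ V ² × (∀ b → b ∈ ℕ∪ V → ¬ b ∈ CodesBelow p)}
      ...   | yes (_ , (x∈ , y∈) , ∄fresh) with bound₂ α∈V x∈ y∈
      ...     | β , β∈V , p≤β = square V↪β ⨾ segments β∈V ⨾ below
        where
        below : ℕ∪ (_< β) ↪ ℕ∪ V
        below = ⊆⇒↪ (λ {x} → ℕ∪-mono {_< β} {V} (λ γ<β → downClosed γ<β β∈V) {x})

        -- V is no larger than a proper segment, so the induction hypothesis already squares it.
        V↪β : ℕ∪ V ↪ ℕ∪ (_< β)
        V↪β = exhausted p≤β ∄fresh ⨾ square absorbTop ⨾ segments β∈V
      squarable | yes _ | no ∄p = record
        { to        = code
        ; maps      = proj₁ ∘ fresh
        ; injective = code-injective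
        }
        where
        fresh : ∀ {p} → p ∈ ℕ∪ V ² → code p ∈ ℕ∪ V × code p ∈ CodesBelow p
        fresh {p} p∈ with em {∃[ b ] b ∈ ℕ∪ V × b ∈ CodesBelow p}
        ... | yes (_ , b∈ , below) = code-fresh b∈ below
        ... | no ∄b = contradiction (p , p∈ , λ b b∈ below → ∄b (b , b∈ , below)) ∄p

        code-injective : ∀ {p q} → p ∈ ℕ∪ V ² → q ∈ ℕ∪ V ² →
          code p ≡ code q → p ≡ q
        code-injective {p} {q} p∈ q∈ eq with em {p ≡ q}
        ... | yes p≡q = p≡q
        -- Of two distinct pairs, the later one avoids the code of the earlier.
        ... | no p≢q with ⊏-connex p q p≢q
        ...   | inj₁ p⊏q = contradiction eq (proj₂ (fresh q∈) p p⊏q)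
        ...   | inj₂ q⊏p = contradiction (sym eq) (proj₂ (fresh p∈) q q⊏p)

    segment-squarable : ∀ α → Squarable (_< α)
    segment-squarable = All.wfRec wellFounded ℓ (λ α → Squarable (_< α))
      λ α rec → Step.squarable (λ γ<β β<α → A.trans γ<β β<α) rec

  -- Along the sequence `ι`, the added copy of ℕ takes the even places and the old terms move to the
  -- odd ones; all else stays fixed.
  absorbℕ : ℕ ↣ A → (ℕ ⊎ A) ↣ A
  absorbℕ ι = mk↣ {to = f} f-injective
    where
    open Injection ι using () renaming (to to i; injective to i-injective)

    f : ℕ ⊎ A → A
    f (inj₁ n) = i (2 ℕ.* n)
    f (inj₂ a) with em {∃[ n ] i n ≡ a}
    ... | yes (n , _) = i (suc (2 ℕ.* n))
    ... | no _        = a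

    f-injective : Injective _≡_ _≡_ f
    f-injective {inj₁ m} {inj₁ n} eq = cong inj₁ (ℕ.*-cancelˡ-≡ m n 2 (i-injective eq))
    f-injective {inj₁ m} {inj₂ b} eq with em {∃[ n ] i n ≡ b}
    ... | yes (n , _) = contradiction (i-injective eq) (ℕ.even≢odd m n)
    ... | no ∄n       = contradiction (_ , eq) ∄n
    f-injective {inj₂ a} {inj₁ n} eq with em {∃[ n ] i n ≡ a}
    ... | yes (m , _) = contradiction (sym (i-injective eq)) (ℕ.even≢odd n m)
    ... | no ∄n       = contradiction (_ , sym eq) ∄n
    f-injective {inj₂ a} {inj₂ b} eq with em {∃[ n ] i n ≡ a} | em {∃[ n ] i n ≡ b}
    ... | no _           | no _           = cong inj₂ eq
    ... | no ∄n          | yes _          = contradiction (_ , sym eq) ∄n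
    ... | yes _          | no ∄n          = contradiction (_ , eq) ∄n
    ... | yes (m , refl) | yes (n , refl) =
      cong (inj₂ ∘ i) (ℕ.*-cancelˡ-≡ m n 2 (ℕ.suc-injective (i-injective eq)))

  -- The induction step, applied to all of `A`, squares `ℕ ⊎ A`; the sequence `ι` then absorbs the
  -- extra ℕ.
  pairing : ℕ ↣ A → (A × A) ↣ A
  pairing ι = mk↣ {to = f} f-injective
    where
    open Injection (absorbℕ ι) using () renaming (to to j; injective to j-injective)

    all-squarable : Squarable (λ _ → ⊤)
    all-squarable = Step.squarable _ (λ {α} _ → segment-squarable α)

    f : A × A → A
    f (a , b) = j (to all-squarable (inj₂ a , inj₂ b))

    f-injective : Injective _≡_ _≡_ f
    f-injective eq with ,-injective (injective all-squarable _ _ (j-injective eq))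
    ... | eq₁ , eq₂ = ×-≡,≡→≡ (inj₂-injective eq₁ , inj₂-injective eq₂)

-- Iterated successors and codes for tuples.

iteratedSuccessor-≼ : ∀ {ℓ} {κ μ : Cardinal ℓ} {m} → IsIteratedSuccessor κ m μ → ∣ κ ∣ ≼ ∣ μ ∣
iteratedSuccessor-≼ (zero κ≈μ)            = Bijection.injection κ≈μ
iteratedSuccessor-≼ (suc κ⁺ᵐ≈ν ((ν≼μ , _) , _)) =
  injection (iteratedSuccessor-≼ κ⁺ᵐ≈ν) ν≼μ

module _ {a} {A : Set a} (pair : (A × A) ↣ A) where

  open Injection pair using () renaming (to to ⟨_⟩; injective to ⟨⟩-injective)

  -- The last component is the seed of the nested pairs, so the empty tuple has a code too.
  codeVec : ∀ {m} → Vec A m × A → A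
  codeVec (as , b) = foldr′ (λ a c → ⟨ a , c ⟩) b as

  codeVec-injective : ∀ {m} → Injective _≡_ _≡_ (codeVec {m})
  codeVec-injective {x = [] , _} {[] , _} refl = refl
  codeVec-injective {x = a ∷ as , b} {a′ ∷ as′ , b′} eq with ,-injective (⟨⟩-injective eq)
  ... | refl , eq′ with refl ← codeVec-injective {x = as , b} {as′ , b′} eq′ = refl

-- Finite joins, breadth and redundant entries.

module JoinProperties {c ℓ} (P : JoinSemilattice c ℓ) where

  open JoinSemilattice P using (Carrier; _≈_; _∨_; setoid; ∨-cong; ∨-congˡ; ∨-congʳ)
    renaming (refl to ≈-refl; sym to ≈-sym; trans to ≈-trans; assoc to ∨-assoc; comm to ∨-comm; idem to ∨-idem)
  open SemilatticeNotions P

  ⊑-reflexive : ∀ {x y} → x ≈ y → x ⊑ y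
  ⊑-reflexive {y = y} x≈y = ≈-trans (∨-congʳ x≈y) (∨-idem y)

  ⊑-refl : ∀ {x} → x ⊑ x
  ⊑-refl = ⊑-reflexive ≈-refl

  ⊑-trans : ∀ {x y z} → x ⊑ y → y ⊑ z → x ⊑ z
  ⊑-trans {x} {y} {z} x⊑y y⊑z =
    ≈-trans (∨-congˡ (≈-sym y⊑z)) (≈-trans (≈-sym (∨-assoc x y z)) (≈-trans (∨-congʳ x⊑y) y⊑z))

  x⊑x∨y : ∀ x y → x ⊑ x ∨ y
  x⊑x∨y x y = ≈-trans (≈-sym (∨-assoc x x y)) (∨-congʳ (∨-idem x))

  y⊑x∨y : ∀ x y → y ⊑ x ∨ y
  y⊑x∨y x y = ⊑-trans (x⊑x∨y y x) (⊑-reflexive (∨-comm y x))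

  ∨-lub : ∀ {x y z} → x ⊑ z → y ⊑ z → x ∨ y ⊑ z
  ∨-lub {x} {y} {z} x⊑z y⊑z = ≈-trans (∨-assoc x y z) (≈-trans (∨-congˡ y⊑z) x⊑z)

  infixr 7 _∨*_

  -- The seed `u` gives a value for empty `xs`, as there may be no least element.
  _∨*_ : ∀ {m} → Vec Carrier m → Carrier → Carrier
  xs ∨* u = foldr′ _∨_ u xs

  ∨*-upperʳ : ∀ {m} (xs : Vec Carrier m) u → u ⊑ xs ∨* u
  ∨*-upperʳ []       u = ⊑-refl
  ∨*-upperʳ (x ∷ xs) u = ⊑-trans (∨*-upperʳ xs u) (y⊑x∨y x (xs ∨* u))

  ∨*-upperˡ : ∀ {m} (xs : Vec Carrier m) u i → lookup xs i ⊑ xs ∨* u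
  ∨*-upperˡ (x ∷ xs) u zero    = x⊑x∨y x (xs ∨* u)
  ∨*-upperˡ (x ∷ xs) u (suc i) = ⊑-trans (∨*-upperˡ xs u i) (y⊑x∨y x (xs ∨* u))

  ∨*-lub : ∀ {m} (xs : Vec Carrier m) {u w} → u ⊑ w → (∀ i → lookup xs i ⊑ w) → xs ∨* u ⊑ w
  ∨*-lub []       u⊑w _    = u⊑w
  ∨*-lub (x ∷ xs) u⊑w xs⊑w = ∨-lub (xs⊑w zero) (∨*-lub xs u⊑w (xs⊑w ∘ suc))

  foldr₁-upper : ∀ {m} (x : Carrier) (xs : Vec Carrier m) i →
    lookup (x ∷ xs) i ⊑ foldr₁ _∨_ (x ∷⁺ toList xs)
  foldr₁-upper x []       zero    = ⊑-refl
  foldr₁-upper x (y ∷ ys) zero    = x⊑x∨y x _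
  foldr₁-upper x (y ∷ ys) (suc i) = ⊑-trans (foldr₁-upper y ys i) (y⊑x∨y x _)

  foldr₁-lub : ∀ x xs {w} → (∀ i → List.lookup (x ∷ xs) i ⊑ w) → foldr₁ _∨_ (x ∷⁺ xs) ⊑ w
  foldr₁-lub x []       xs⊑w = xs⊑w zero
  foldr₁-lub x (y ∷ ys) xs⊑w = ∨-lub (xs⊑w zero) (foldr₁-lub y ys (xs⊑w ∘ suc))

  isJoin-lub : ∀ {xs z w} → IsJoin xs z → (∀ i → List.lookup xs i ⊑ w) → z ⊑ w
  isJoin-lub (empty z⊑)                  _    = z⊑ _
  isJoin-lub (nonempty {x} {xs} xs≈z) xs⊑w =
    ⊑-trans (⊑-reflexive (≈-sym xs≈z)) (foldr₁-lub x xs xs⊑w)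

  -- The entry lies below the join of the others, phrased through upper bounds since an empty join
  -- need not exist.
  Redundant : ∀ {m} → Vec Carrier m → Fin m → Set _
  Redundant xs i = ∀ w → (∀ j → j ≢ i → lookup xs j ⊑ w) → lookup xs i ⊑ w

  -- Pigeonhole: the at most `m` entries of `Y` miss some position `i` of `xs`. That entry lies
  -- below the join of `Y`, hence below every bound of the other entries.
  breadth⇒redundant : ∀ {n m} → BreadthAtMost n → n ℕ.≤ m →
    ∀ (xs : Vec Carrier (suc m)) → ∃[ i ] Redundant xs i
  breadth⇒redundant {n} {m} breadth n≤m xs@(x ∷ xs′) with breadth (x ∷⁺ toList xs′)
  ... | Y , Y⊆xs , |Y|≤n , Y-join =
    let i , i∉f = ¬∀⟶∃¬ (suc m) _ (λ i → any? λ j → f j ≟ i) not-onto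
    in i , λ w xs⊑w → ⊑-trans (foldr₁-upper x xs′ i) $ isJoin-lub Y-join λ j →
      ⊑-trans (⊑-reflexive (f-position j)) (xs⊑w (f j) λ fj≡i → i∉f (j , fj≡i))
    where
    membership = λ j → toList⁻ {xs = xs} (Y⊆xs (Membership.∈-lookup setoid Y j))

    f : Fin (length Y) → Fin (suc m)
    f j = index (membership j)

    f-position : ∀ j → List.lookup Y j ≈ lookup xs (f j)
    f-position j = lookup-index (membership j)

    not-onto : ¬ (∀ i → ∃[ j ] f j ≡ i)
    not-onto onto = ℕ.≤⇒≯ (ℕ.≤-trans |Y|≤n n≤m) $ injective⇒≤ {f = proj₁ ∘ onto}
      λ {i} {i′} eq → trans (sym (proj₂ (onto i))) (trans (cong f eq) (proj₂ (onto i′)))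

  -- Free sequences and the chain they yield.

  module _ {i} (I : Pred Carrier i) where

    -- The base `z` collects the entries already passed, so each entry is tested against all the
    -- others.
    Free : ∀ {m} → Carrier → Vec Carrier m → Set (c ⊔ ℓ ⊔ i)
    Free z []       = ⊤
    Free z (x ∷ xs) = (∀ {u} → u ∈ I → ¬ x ⊑ z ∨ xs ∨* u) × Free (z ∨ x) xs

    -- By induction on the sequence: a bound of `z ∨ x` bounds both the old base and the head, so
    -- redundancy of a later entry passes to the tail.
    free⇒irredundant : ∀ {m z u} (xs : Vec Carrier m) → Free z xs → u ∈ I → ∀ i →
      ¬ (∀ w → z ⊑ w → u ⊑ w → (∀ j → j ≢ i → lookup xs j ⊑ w) → lookup xs i ⊑ w)
    free⇒irredundant {z = z} {u} (x ∷ xs) (x⋢ , _) u∈I zero redundant =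
      x⋢ u∈I $ redundant (z ∨ xs ∨* u) (x⊑x∨y z _)
        (⊑-trans (∨*-upperʳ xs u) (y⊑x∨y z _))
        λ { zero 0≢0 → contradiction refl 0≢0
          ; (suc j) _ → ⊑-trans (∨*-upperˡ xs u j) (y⊑x∨y z _) }
    free⇒irredundant {z = z} (x ∷ xs) (_ , free) u∈I (suc i) redundant =
      free⇒irredundant xs free u∈I i λ w z∨x⊑w u⊑w xs⊑w →
        redundant w (⊑-trans (x⊑x∨y z x) z∨x⊑w) u⊑w
          λ { zero _ → ⊑-trans (y⊑x∨y z x) z∨x⊑w
            ; (suc j) j≢i → xs⊑w j (j≢i ∘ cong suc) }

    free⇒chain : ∀ {m n z} → BreadthAtMost n → n ℕ.≤ suc m → IsIdeal I →
      (xs : Vec Carrier m) → Free z xs → IsChain ((xs ∨* z) ∨ˢ I)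
    free⇒chain {z = z} breadth n≤1+m ideal xs free {p} {q} (u , u∈I , p≈) (v , v∈I , q≈)
      -- This list has `suc (suc m)` entries, one more than the breadth bound `suc m`.
      with breadth⇒redundant breadth n≤1+m (u ∷ v ∷ xs)
    -- `u` is redundant, and `(xs ∨* z) ∨ v` bounds `v` and all of `xs`.
    ... | zero , redundant = inj₁ $ ⊑-trans (⊑-reflexive p≈) $ ⊑-trans
      (∨-lub (x⊑x∨y _ v) $ redundant _
        λ { zero 0≢0 → contradiction refl 0≢0
          ; (suc zero) _ → y⊑x∨y _ v
          ; (suc (suc j)) _ → ⊑-trans (∨*-upperˡ xs z j) (x⊑x∨y _ v) })
      (⊑-reflexive (≈-sym q≈))
    ... | suc zero , redundant = inj₂ $ ⊑-trans (⊑-reflexive q≈) $ ⊑-trans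
      (∨-lub (x⊑x∨y _ u) $ redundant _
        λ { zero _ → y⊑x∨y _ u
          ; (suc zero) 1≢1 → contradiction refl 1≢1
          ; (suc (suc j)) _ → ⊑-trans (∨*-upperˡ xs z j) (x⊑x∨y _ u) })
      (⊑-reflexive (≈-sym p≈))
    -- Freeness admits a single element of `I`, so `u ∨ v` stands in for both.
    ... | suc (suc i) , redundant = ⊥-elim $
      free⇒irredundant xs free (IsIdeal.∨-closed ideal u∈I v∈I) i λ w _ u∨v⊑w xs⊑w → redundant w
        λ { zero _ → ⊑-trans (x⊑x∨y u v) u∨v⊑w
          ; (suc zero) _ → ⊑-trans (y⊑x∨y u v) u∨v⊑w
          ; (suc (suc j)) j≢i → xs⊑w j (j≢i ∘ cong suc ∘ cong suc) }

-- Existence of free sequences by counting.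

module FreeSequences {ℓ} (em : ExcludedMiddle ℓ) {κ : Cardinal ℓ} (infinite : Infinite κ)
  (P : JoinSemilattice ℓ ℓ) where

  open JoinSemilattice P using (Carrier; _≈_; _∨_; setoid)
    renaming (refl to ≈-refl; sym to ≈-sym; trans to ≈-trans)
  open SemilatticeNotions P
  open JoinProperties P

  module _ {μ : Cardinal ℓ} (enumeration : HasCardinality setoid μ)
    (small : ∀ x → subset setoid (↓ x) ≺ ∣ κ ∣)
    {I : Pred Carrier ℓ} (I≼κ : subset setoid I ≼ ∣ κ ∣) where

    open Bijection enumeration using (surjective)
      renaming (to to index-of; cong to index-of-cong; injective to index-of-injective)

    -- The injections supplied by small need not respect _≈_, hence the fixed representatives.
    canonical : Cardinal.Carrier μ → Carrier
    canonical d = proj₁ (surjective d)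

    canonical-index : ∀ x → canonical (index-of x) ≈ x
    canonical-index x = index-of-injective (proj₂ (surjective (index-of x)) ≈-refl)

    below : ∀ {x y} → x ⊑ y → Cardinal.Carrier κ
    below {x} {y} x⊑y = Injection.to (proj₁ (small (canonical (index-of y))))
      (x , ⊑-trans x⊑y (⊑-reflexive (≈-sym (canonical-index y))))

    -- Equivalent bounds have equal indices, so both positions come from one injection. In `same`
    -- the indices are variables, which allows matching on `refl`.
    below-injective : ∀ {x y x′ y′} (x⊑y : x ⊑ y) (x′⊑y′ : x′ ⊑ y′) → y ≈ y′ →
      below x⊑y ≡ below x′⊑y′ → x ≈ x′
    below-injective {y = y} {y′ = y′} x⊑y x′⊑y′ y≈y′ eq = same (index-of-cong y≈y′) _ _ eq
      where
      same : ∀ {d d′} → d ≡ d′ → ∀ p q →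
        Injection.to (proj₁ (small (canonical d))) p ≡ Injection.to (proj₁ (small (canonical d′))) q →
        proj₁ p ≈ proj₁ q
      same {d} refl _ _ = Injection.injective (proj₁ (small (canonical d)))

    ∨*-cong : ∀ {m u v} (xs : Vec Carrier m) → u ≈ v → xs ∨* u ≈ xs ∨* v
    ∨*-cong []       u≈v = u≈v
    ∨*-cong (x ∷ xs) u≈v = JoinSemilattice.∨-congˡ P (∨*-cong xs u≈v)

    -- Quantifying over all tails `as` allows the head to be chosen first: an uncovered `x` stays
    -- good whichever tail follows.
    Covered : ∀ {N : Set ℓ} m → (N → Carrier) → Carrier → Carrier → Set ℓ
    Covered m e z x = ∃[ as ] ∃[ u ] u ∈ I × x ⊑ z ∨ map {n = m} e as ∨* u

    -- Tails are drawn from the smaller `ν`, so there are few of them to avoid. The base `z` is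
    -- arbitrary because the recursion adds the chosen head to it.
    freeSequence : ∀ {m ν} → IsIteratedSuccessor κ m ν → (e : ∣ ν ∣ ≼ setoid) → ∀ z →
      ∃[ as ] Free I {m} z (map (Injection.to e) as)
    freeSequence (zero _) e z = [] , _
    freeSequence {suc m} {ν⁺} (suc {ν = ν} κ⁺ᵐ≈ν ((ν≼ν⁺ , ν⁺⋠ν) , _)) e z 
      with em {∃[ c ] ¬ Covered m (Injection.to e ∘ Injection.to ν≼ν⁺) z (Injection.to e c)}
    ... | yes (c , uncovered) =
      let as , free = freeSequence κ⁺ᵐ≈ν (injection ν≼ν⁺ e) (z ∨ Injection.to e c)
          xs≡       = map-∘ (Injection.to e) (Injection.to ν≼ν⁺) as
      in c ∷ map (Injection.to ν≼ν⁺) as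
       , subst (λ xs → Free I z (Injection.to e c ∷ xs)) xs≡
           ((λ u∈I ⊑zu → uncovered (as , _ , u∈I , ⊑zu)) , free)
    -- If every candidate were covered, coding the witnesses would inject `ν⁺` into `ν`.
    ... | no ∄uncovered = contradiction (mk↣ {to = code} code-injective) ν⁺⋠ν
      where
      κ≼ν : ∣ κ ∣ ≼ ∣ ν ∣
      κ≼ν = iteratedSuccessor-≼ κ⁺ᵐ≈ν

      open Injection κ≼ν using () renaming (to to j; injective to j-injective)

      pair : (Cardinal.Carrier ν × Cardinal.Carrier ν) ↣ Cardinal.Carrier ν
      pair = Hessenberg.pairing em (Cardinal.isStrictTotalOrder ν) (Cardinal.wellFounded ν)
        (injection infinite κ≼ν)

      CoveredAt : Cardinal.Carrier ν⁺ → Set ℓ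
      CoveredAt c = Covered m (Injection.to e ∘ Injection.to ν≼ν⁺) z (Injection.to e c)

      covered : ∀ c → CoveredAt c
      covered c with em {CoveredAt c}
      ... | yes p = p
      ... | no ¬p = contradiction (c , ¬p) ∄uncovered

      codeOf : ∀ {c} → CoveredAt c → Vec (Cardinal.Carrier ν) m × Cardinal.Carrier ν
      codeOf (as , u , u∈I , c⊑) =
        as , Injection.to pair (j (Injection.to I≼κ (u , u∈I)) , j (below c⊑))

      -- Equal tails and equivalent elements of `I` give equivalent bounds, below which the position
      -- determines the candidate.
      codeOf-injective : ∀ {c d} (p : CoveredAt c) (q : CoveredAt d) → codeOf p ≡ codeOf q → c ≡ d
      codeOf-injective (as , u , u∈I , c⊑) (as′ , v , v∈I , d⊑) eq with ,-injective eq
      ... | refl , eq₁ with ,-injective (Injection.injective pair eq₁)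
      ...   | eq₂ , eq₃ = Injection.injective e (below-injective c⊑ d⊑
        (JoinSemilattice.∨-congˡ P (∨*-cong (map _ as) (Injection.injective I≼κ (j-injective eq₂))))
        (j-injective eq₃))

      code : Cardinal.Carrier ν⁺ → Cardinal.Carrier ν
      code c = codeVec pair (codeOf (covered c))

      code-injective : Injective _≡_ _≡_ code
      code-injective {c} {d} eq =
        codeOf-injective (covered c) (covered d) (codeVec-injective pair eq)

theorem2p6 : ∀ {ℓ} → ExcludedMiddle ℓ →
    ∀ (κ : Cardinal ℓ) → Infinite κ →
    ∀ (n : ℕ) .{{_ : NonZero n}} →
    ∀ (μ : Cardinal ℓ) → IsIteratedSuccessor κ (n ∸ 1) μ →
    ∀ (P : JoinSemilattice ℓ ℓ) →
    let open JoinSemilattice P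
        open SemilatticeNotions P in
    HasBreadth n →
    HasCardinality setoid μ →
    (∀ x → subset setoid (↓ x) ≺ ∣ κ ∣) →
    ∀ (I : Pred Carrier ℓ) → IsIdeal I → subset setoid I ≼ ∣ κ ∣ →
    ∃[ x ] IsChain (x ∨ˢ I)
theorem2p6 em κ infinite n μ κ⁺ⁿ⁻¹≈μ P (breadth , _) enumeration small I ideal I≼κ =
  let z , _     = IsIdeal.inhabited ideal
      as , free = freeSequence {μ} enumeration small I≼κ κ⁺ⁿ⁻¹≈μ enumerate z
  -- The witness is the join of `z` with the free sequence of length `n ∸ 1`; as `n` is positive,
  -- `suc (n ∸ 1)` is `n`.
  in _ , free⇒chain I breadth (ℕ.≤-reflexive (sym (ℕ.suc-pred n))) ideal (map _ as) free
  where
  open SemilatticeNotions P using (module IsIdeal)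
  open JoinProperties P using (free⇒chain)
  open FreeSequences em infinite P using (freeSequence)

  enumerate : ∣ μ ∣ ≼ JoinSemilattice.setoid P
  enumerate = Bijection.injection (sym-≡ enumeration)
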